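{- Let $\tau\ge1$, $\sigma=(\sigma_1,\dots,\sigma_\tau)\in\mathbb{Z}_{\ge1}^\tau$, and define $S:=\prod_{i=1}^\tau(\sigma_i+1)$. (i) Let $\mathcal{A}$ be an integer matrix such that $\mathcal{A}^\intercal\in\mathbb{Z}^{S\times(S-1)}$ is bi-diagonal. Then, up to a permutation of its rows, $\mathcal{A}$ is a tree-fold matrix with $\tau$ levels and level sizes $\sigma$. (ii) Let $\mathcal{A}$ be an integer matrix such that $\mathcal{A}^\intercal\in\mathbb{Z}^{2S\times(2S-2)}$ is tri-diagonal. Then, up to a permutation of its rows, $\mathcal{A}$ is a tree-fold matrix with $\tau$ levels and level sizes $2\sigma=(2\sigma_1,\dots,2\sigma_\tau)$.
   Context: A matrix $M=(m_{i,j})$ with integer entries is bi-diagonal if $m_{i,j}=0$ whenever $i\notin\{j,j+1\}$, and tri-diagonal if $m_{i,j}=0$ whenever $i\notin\{j,j+1,j+2\}$. Tree-fold matrices (recursive definition): any matrix $A\in\mathbb{Z}^{m\times n}$ is a tree-fold matrix with one level and level size $m$. A matrix $A$ is a tree-fold matrix with $\tau\ge 2$ levels and level sizes $\sigma=(\sigma_1,\dots,\sigma_\tau)\in\mathbb{Z}_{\ge1}^\tau$ if deleting the first $\sigma_1$ rows of $A$ decomposes the matrix into a block-diagonal matrix, where each (not necessarily square) block is a tree-fold matrix with $\tau-1$ levels and level sizes $(\sigma_2,\dots,\sigma_\tau)$. -}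

module Defs where

open import Data.Fin using (Fin; toℕ; _↑ˡ_; _↑ʳ_)
open import Data.Fin.Permutation using (Permutation′; _⟨$⟩ʳ_)
open import Data.Integer using (ℤ; 0ℤ)
open import Data.Nat using (ℕ; suc; _+_; _*_)
open import Data.Product using (Σ-syntax)
open import Data.Sum using (_⊎_)
open import Data.Vec using (Vec; []; _∷_; map; foldr′)
open import Data.Vec.Functional using (Vector; drop; rearrange)
open import Relation.Binary.PropositionalEquality using (_≡_)
open import Relation.Nullary using (¬_)

Matrix : ℕ → ℕ → Set
Matrix m n = Vector (Vector ℤ n) m

-- Indices are 0-based; the conditions only involve the difference i - j.
BiDiagonal : ∀ {m n} → Matrix m n → Set
BiDiagonal M = ∀ i j →
  ¬ (toℕ i ≡ toℕ j ⊎ toℕ i ≡ toℕ j + 1) → M i j ≡ 0ℤ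

TriDiagonal : ∀ {m n} → Matrix m n → Set
TriDiagonal M = ∀ i j →
  ¬ (toℕ i ≡ toℕ j ⊎ toℕ i ≡ toℕ j + 1 ⊎ toℕ i ≡ toℕ j + 2) → M i j ≡ 0ℤ

-- A is block-diagonal with one or more blocks, of arbitrary and possibly
-- different dimensions, each of which satisfies P.  Both the rows and the
-- columns of A are split into consecutive intervals.
data BlockDiagonal (P : ∀ {m n} → Matrix m n → Set) :
                   ∀ {m n} → Matrix m n → Set where
  single : ∀ {m n} {A : Matrix m n} → P A → BlockDiagonal P A
  cons   : ∀ {m₁ m₂ n₁ n₂} {A : Matrix (m₁ + m₂) (n₁ + n₂)} →
           P (λ (i : Fin m₁) (j : Fin n₁) → A (i ↑ˡ m₂) (j ↑ˡ n₂)) →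
           (∀ (i : Fin m₁) (j : Fin n₂) → A (i ↑ˡ m₂) (n₁ ↑ʳ j) ≡ 0ℤ) →
           (∀ (i : Fin m₂) (j : Fin n₁) → A (m₁ ↑ʳ i) (j ↑ˡ n₂) ≡ 0ℤ) →
           BlockDiagonal P
             (λ (i : Fin m₂) (j : Fin n₂) → A (m₁ ↑ʳ i) (n₁ ↑ʳ j)) →
           BlockDiagonal P A

-- There are no tree-fold matrices with τ = 0 levels.
data IsTreeFold : ∀ {τ} → Vec ℕ τ → ∀ {m n} → Matrix m n → Set where
  one-level : ∀ {m n} (A : Matrix m n) → IsTreeFold (m ∷ []) A
  add-level : ∀ {τ s m n} {σ : Vec ℕ (suc τ)} (A : Matrix (s + m) n) →
              BlockDiagonal (IsTreeFold σ) (drop s A) →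
              IsTreeFold (s ∷ σ) A

IsTreeFoldUpToRowPermutation : ∀ {τ} → Vec ℕ τ → ∀ {m n} → Matrix m n → Set
IsTreeFoldUpToRowPermutation σ {m} A =
  Σ[ π ∈ Permutation′ m ] IsTreeFold σ (rearrange (π ⟨$⟩ʳ_) A)

∏[1+_] : ∀ {τ} → Vec ℕ τ → ℕ
∏[1+ σ ] = foldr′ _*_ 1 (map (_+ 1) σ)

{-# OPTIONS --safe #-}
-- In a matrix whose i-th row is supported on the columns i, …, i + d, deleting d
-- consecutive rows, say those with indices v, …, v + d - 1, decouples the columns
-- below v + d from the remaining ones.  Put w = d * (σ₂ + 1) ⋯ (σ_τ + 1).  Deleting
-- the d rows just before each of the rows w, 2w, …, σ₁w leaves σ₁ + 1 diagonal blocks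
-- of w - d rows and w columns, which are banded again, so one recurses on the levels.
-- The cases d = 1 and d = 2 are the bi-diagonal and the tri-diagonal one.
module Submission where

open import Defs
open import Data.Fin using (Fin; toℕ; _↑ˡ_; _↑ʳ_)
open import Data.Fin.Permutation using (Permutation; _⟨$⟩ʳ_; ↔⇒≡) renaming (id to idₚ)
open import Data.Fin.Properties using (toℕ<n; toℕ-↑ˡ; toℕ-↑ʳ; splitAt-↑ˡ; splitAt-↑ʳ; +↔⊎)
open import Data.Integer using (0ℤ)
open import Data.Nat using (ℕ; zero; suc; _+_; _*_; _∸_; _≤_; _<_; z≤n; s≤s)
open import Data.Nat.Properties
open import Data.Nat.Tactic.RingSolver using (solve-∀)
open import Data.Product using (_×_; _,_; ∃-syntax; Σ-syntax)
open import Data.Sum using (_⊎_; inj₁; inj₂)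
open import Data.Sum.Function.Propositional using (_⊎-↔_)
open import Data.Vec using (Vec; []; _∷_; map)
open import Data.Vec.Functional using (transpose; rearrange)
open import Data.Vec.Properties using (map-cong; map-id)
open import Data.Vec.Relation.Unary.All using (All)
open import Function.Bundles using (_↔_; Inverse; mk↔ₛ′)
open import Function.Construct.Composition using () renaming (inverse to infixr 5 _⨾_)
open import Function.Construct.Identity using (↔-id)
open import Function.Construct.Symmetry using (↔-sym)
open import Relation.Binary.PropositionalEquality
open import Relation.Nullary using (¬_)

-- Composed row permutations reproduce a matrix only entry by entry, so without function
-- extensionality the predicate has to be carried over by induction.
IsTreeFold-cong : ∀ {τ m n} {σ : Vec ℕ τ} {A B : Matrix m n} →
  (∀ i j → A i j ≡ B i j) → IsTreeFold σ A → IsTreeFold σ B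

BlockDiagonal-cong : ∀ {τ m n} {σ : Vec ℕ τ} {A B : Matrix m n} →
  (∀ i j → A i j ≡ B i j) →
  BlockDiagonal (IsTreeFold σ) A → BlockDiagonal (IsTreeFold σ) B

IsTreeFold-cong A≗B (one-level _)           = one-level _
IsTreeFold-cong A≗B (add-level {s = s} _ D) =
  add-level _ (BlockDiagonal-cong (λ i → A≗B (s ↑ʳ i)) D)

BlockDiagonal-cong A≗B (single t) = single (IsTreeFold-cong A≗B t)
BlockDiagonal-cong A≗B (cons {m₁} {m₂} {n₁} {n₂} t upper lower D) = cons
  (IsTreeFold-cong (λ i j → A≗B (i ↑ˡ m₂) (j ↑ˡ n₂)) t)
  (λ i j → trans (sym (A≗B (i ↑ˡ m₂) (n₁ ↑ʳ j))) (upper i j))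
  (λ i j → trans (sym (A≗B (m₁ ↑ʳ i) (j ↑ˡ n₂))) (lower i j))
  (BlockDiagonal-cong (λ i j → A≗B (m₁ ↑ʳ i) (n₁ ↑ʳ j)) D)

-- Like IsTreeFoldUpToRowPermutation, but the number of rows may change along a
-- propositional equality, which spares transports.
TreeFoldable : ∀ {τ} → Vec ℕ τ → ∀ {m n} → Matrix m n → Set
TreeFoldable σ {m} A =
  ∃[ k ] Σ[ π ∈ Permutation k m ] IsTreeFold σ (rearrange (π ⟨$⟩ʳ_) A)

TreeFoldable⇒IsTreeFoldUpToRowPermutation : ∀ {τ m n} {σ : Vec ℕ τ} (A : Matrix m n) →
  TreeFoldable σ A → IsTreeFoldUpToRowPermutation σ A
TreeFoldable⇒IsTreeFoldUpToRowPermutation A (_ , π , t) with refl ← ↔⇒≡ π = π , t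

Banded : ℕ → ∀ {m n} → Matrix m n → Set
Banded d A = ∀ i j → toℕ j < toℕ i ⊎ toℕ i + d < toℕ j → A i j ≡ 0ℤ

-- suc s blocks of length b, separated by s gaps of length g
chain : ℕ → ℕ → ℕ → ℕ
chain b g zero    = b
chain b g (suc s) = b + (g + chain b g s)

-- One more gap after the last block completes `suc s` equal pieces of length `b + g`.
chain+gap : ∀ b g s → chain b g s + g ≡ suc s * (b + g)
chain+gap b g zero    = sym (+-identityʳ (b + g))
chain+gap b g (suc s) = trans (reassoc b g (chain b g s)) (cong (b + g +_) (chain+gap b g s))
  where
  reassoc : ∀ b g c → b + (g + c) + g ≡ b + g + (c + g)
  reassoc = solve-∀

module _ {m₁ m₂ n₂ d} {A : Matrix (m₁ + (d + m₂)) (m₁ + d + n₂)} (banded : Banded d A) where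

  private
    n₁ : ℕ
    n₁ = m₁ + d

    toℕ-↑ʳ² : ∀ (i : Fin m₂) → toℕ (m₁ ↑ʳ (d ↑ʳ i)) ≡ n₁ + toℕ i
    toℕ-↑ʳ² i rewrite toℕ-↑ʳ m₁ (d ↑ʳ i) | toℕ-↑ʳ d i = sym (+-assoc m₁ d (toℕ i))

  Banded-upperLeft : Banded d λ (i : Fin m₁) (j : Fin n₁) → A (i ↑ˡ (d + m₂)) (j ↑ˡ n₂)
  Banded-upperLeft i j off = banded (i ↑ˡ (d + m₂)) (j ↑ˡ n₂)
    (subst₂ (λ a b → b < a ⊎ a + d < b) (sym (toℕ-↑ˡ i (d + m₂))) (sym (toℕ-↑ˡ j n₂)) off)

  -- A row of index below `m₁` reaches no column from `m₁ + d` on; hence the left block gets `d`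
  -- more columns than rows.
  Banded-upperRight : ∀ (i : Fin m₁) (j : Fin n₂) → A (i ↑ˡ (d + m₂)) (n₁ ↑ʳ j) ≡ 0ℤ
  Banded-upperRight i j = banded (i ↑ˡ (d + m₂)) (n₁ ↑ʳ j) (inj₂ (begin-strict
    toℕ (i ↑ˡ (d + m₂)) + d  ≡⟨ cong (_+ d) (toℕ-↑ˡ i (d + m₂)) ⟩
    toℕ i + d                <⟨ +-monoˡ-< d (toℕ<n i) ⟩
    n₁                       ≤⟨ m≤m+n n₁ (toℕ j) ⟩
    n₁ + toℕ j               ≡⟨ toℕ-↑ʳ n₁ j ⟨
    toℕ (n₁ ↑ʳ j)            ∎))
    where open ≤-Reasoning

  Banded-lowerLeft : ∀ (i : Fin m₂) (j : Fin n₁) → A (m₁ ↑ʳ (d ↑ʳ i)) (j ↑ˡ n₂) ≡ 0ℤ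
  Banded-lowerLeft i j = banded (m₁ ↑ʳ (d ↑ʳ i)) (j ↑ˡ n₂) (inj₁ (begin-strict
    toℕ (j ↑ˡ n₂)             ≡⟨ toℕ-↑ˡ j n₂ ⟩
    toℕ j                     <⟨ toℕ<n j ⟩
    n₁                        ≤⟨ m≤m+n n₁ (toℕ i) ⟩
    n₁ + toℕ i                ≡⟨ toℕ-↑ʳ² i ⟨
    toℕ (m₁ ↑ʳ (d ↑ʳ i))      ∎))
    where open ≤-Reasoning

  -- The `d` deleted rows make up for the `d` extra columns of the left block: rows and columns both
  -- shift by `n₁`, so the band stays on the diagonal.
  Banded-lowerRight : Banded d λ (i : Fin m₂) (j : Fin n₂) → A (m₁ ↑ʳ (d ↑ʳ i)) (n₁ ↑ʳ j)
  Banded-lowerRight i j off = banded (m₁ ↑ʳ (d ↑ʳ i)) (n₁ ↑ʳ j)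
    (subst₂ (λ a b → b < a ⊎ a + d < b) (sym (toℕ-↑ʳ² i)) (sym (toℕ-↑ʳ n₁ j)) (shift off))
    where
    shift : toℕ j < toℕ i ⊎ toℕ i + d < toℕ j →
            n₁ + toℕ j < n₁ + toℕ i ⊎ n₁ + toℕ i + d < n₁ + toℕ j
    shift (inj₁ j<i)   = inj₁ (+-monoʳ-< n₁ j<i)
    shift (inj₂ i+d<j) = inj₂ (subst (_< n₁ + toℕ j) (sym (+-assoc n₁ (toℕ i) d))
                                     (+-monoʳ-< n₁ i+d<j))

-- Here `A` is the first gap, `B` the other gaps, `C` the first block and `D` the other blocks. On
-- the right, first block and first gap are in their original order; `B ⊎ D` is left to the
-- induction.
⊎-rotate : ∀ {A B C D : Set} → ((A ⊎ B) ⊎ (C ⊎ D)) ↔ (C ⊎ (A ⊎ (B ⊎ D)))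
⊎-rotate = mk↔ₛ′
  (λ { (inj₁ (inj₁ a)) → inj₂ (inj₁ a)
     ; (inj₁ (inj₂ b)) → inj₂ (inj₂ (inj₁ b))
     ; (inj₂ (inj₁ c)) → inj₁ c
     ; (inj₂ (inj₂ d)) → inj₂ (inj₂ (inj₂ d)) })
  (λ { (inj₁ c)               → inj₂ (inj₁ c)
     ; (inj₂ (inj₁ a))        → inj₁ (inj₁ a)
     ; (inj₂ (inj₂ (inj₁ b))) → inj₁ (inj₂ b)
     ; (inj₂ (inj₂ (inj₂ d))) → inj₂ (inj₂ d) })
  (λ { (inj₁ _) → refl ; (inj₂ (inj₁ _)) → refl
     ; (inj₂ (inj₂ (inj₁ _))) → refl ; (inj₂ (inj₂ (inj₂ _))) → refl })
  (λ { (inj₁ (inj₁ _)) → refl ; (inj₁ (inj₂ _)) → refl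
     ; (inj₂ (inj₁ _)) → refl ; (inj₂ (inj₂ _)) → refl })

-- inj₁ selects the rows of the gaps, inj₂ the rows of the diagonal blocks.
Banded-chain : ∀ {τ} {σ : Vec ℕ τ} d v →
  (∀ (B : Matrix v (v + d)) → Banded d B → TreeFoldable σ B) →
  ∀ s (A : Matrix (chain v d s) (chain (v + d) 0 s)) → Banded d A →
  ∃[ k ] Σ[ π ∈ (Fin (s * d) ⊎ Fin k) ↔ Fin (chain v d s) ]
    BlockDiagonal (IsTreeFold σ) (λ i → A (Inverse.to π (inj₂ i)))
Banded-chain d v fold zero A banded =
  let k , π , t = fold A banded
  in  k , ↔-sym (+↔⊎ {0}) ⨾ π , single t
Banded-chain {σ = σ} d v fold (suc s) A banded =
  -- The zero gap vanishes by computation, so the columns number `v + d + c`, as the cut after `v`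
  -- rows and `v + d` columns requires.
  let k₁ , π₁ , t = fold _ (Banded-upperLeft banded)
      k₂ , π₂ , D = Banded-chain d v fold s _ (Banded-lowerRight banded)
  in  k₁ + k₂ , joined π₁ π₂ , blocks π₁ π₂ t D
  where
  r c : ℕ
  r = chain v d s
  c = chain (v + d) 0 s

  module _ {k₁ k₂} (π₁ : Permutation k₁ v) (π₂ : (Fin (s * d) ⊎ Fin k₂) ↔ Fin r) where
    joined : (Fin (suc s * d) ⊎ Fin (k₁ + k₂)) ↔ Fin (chain v d (suc s))
    joined = (+↔⊎ ⊎-↔ +↔⊎) ⨾ ⊎-rotate ⨾ (π₁ ⊎-↔ ((↔-id _ ⊎-↔ π₂) ⨾ ↔-sym +↔⊎)) ⨾ ↔-sym +↔⊎

    joined-↑ˡ : ∀ i → Inverse.to joined (inj₂ (i ↑ˡ k₂)) ≡ Inverse.to π₁ i ↑ˡ (d + r)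
    joined-↑ˡ i rewrite splitAt-↑ˡ k₁ i k₂ = refl

    joined-↑ʳ : ∀ i → Inverse.to joined (inj₂ (k₁ ↑ʳ i)) ≡ v ↑ʳ (d ↑ʳ Inverse.to π₂ (inj₂ i))
    joined-↑ʳ i rewrite splitAt-↑ʳ k₁ k₂ i = refl

    blocks :
      IsTreeFold σ (λ i j → A (Inverse.to π₁ i ↑ˡ (d + r)) (j ↑ˡ c)) →
      BlockDiagonal (IsTreeFold σ)
        (λ i j → A (v ↑ʳ (d ↑ʳ Inverse.to π₂ (inj₂ i))) ((v + d) ↑ʳ j)) →
      BlockDiagonal (IsTreeFold σ) (λ i → A (Inverse.to joined (inj₂ i)))
    blocks t D = cons
      (IsTreeFold-cong (λ i j → cong (λ x → A x (j ↑ˡ c)) (sym (joined-↑ˡ i))) t)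
      -- The corners vanish in every row on their side of the cut, so permuting rows within each
      -- side preserves them.
      (λ i j → trans (cong (λ x → A x ((v + d) ↑ʳ j)) (joined-↑ˡ i))
                     (Banded-upperRight banded (Inverse.to π₁ i) j))
      (λ i j → trans (cong (λ x → A x (j ↑ˡ c)) (joined-↑ʳ i))
                     (Banded-lowerLeft banded (Inverse.to π₂ (inj₂ i)) j))
      (BlockDiagonal-cong (λ i j → cong (λ x → A x ((v + d) ↑ʳ j)) (sym (joined-↑ʳ i))) D)

-- Listed first, the gap rows become the rows deleted at the top level.
Banded-chain⇒TreeFoldable : ∀ {τ} {σ : Vec ℕ (suc τ)} d v s →
  (∀ (B : Matrix v (v + d)) → Banded d B → TreeFoldable σ B) →
  ∀ (A : Matrix (chain v d s) (chain (v + d) 0 s)) → Banded d A →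
  TreeFoldable (d * s ∷ σ) A
Banded-chain⇒TreeFoldable {σ = σ} d v s fold A banded
  with k , π , D ← Banded-chain d v fold s A banded
  -- The gaps are counted as `s * d` rows, the level size is written `d * s`.
  rewrite *-comm d s
  = s * d + k , +↔⊎ ⨾ π , add-level _ (BlockDiagonal-cong tail D)
  where
  tail : ∀ i j → A (Inverse.to π (inj₂ i)) j ≡ A (Inverse.to (+↔⊎ ⨾ π) (s * d ↑ʳ i)) j
  tail i j rewrite splitAt-↑ʳ (s * d) k i = refl

∏[1+]-positive : ∀ {τ} (σ : Vec ℕ τ) → 1 ≤ ∏[1+ σ ]
∏[1+]-positive []      = s≤s z≤n
∏[1+]-positive (s ∷ σ) = *-mono-≤ (m≤n+m 1 s) (∏[1+]-positive σ)

-- Dimensions given by equations fit both the `S ∸ 1` by `S` matrices and the `v` by `v + d` blocks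
-- of the recursion.
Banded⇒TreeFoldable : ∀ d {τ} (σ : Vec ℕ (suc τ)) {m n} → m + d ≡ n → n ≡ d * ∏[1+ σ ] →
  (A : Matrix m n) → Banded d A → TreeFoldable (map (d *_) σ) A
-- A single level constrains only the number of rows, which is `d * (s + 1)` minus `d`.
Banded⇒TreeFoldable d (s ∷ []) {m} m+d≡n n≡d*∏ A _ =
  foldable (+-cancelʳ-≡ d m (d * s) (trans m+d≡n (trans n≡d*∏ (expand d s))))
  where
  foldable : m ≡ d * s → TreeFoldable (d * s ∷ []) A
  foldable refl = m , idₚ , one-level A

  expand : ∀ d s → d * ((s + 1) * 1) ≡ d * s + d
  expand = solve-∀
Banded⇒TreeFoldable d (s ∷ σ@(_ ∷ _)) {m} {n} m+d≡n n≡d*∏ A banded =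
  foldable (+-cancelʳ-≡ d m (chain v d s) (trans m+d≡n (trans n≡d*∏ (sym rows+d≡d*∏)))) n≡cols
  where
  P v : ℕ
  P = ∏[1+ σ ]
  -- The subtraction is exact, since `P` is at least 1.
  v = d * P ∸ d

  v+d≡d*P : v + d ≡ d * P
  v+d≡d*P = m∸n+n≡m (subst (_≤ d * P) (*-identityʳ d) (*-monoʳ-≤ d (∏[1+]-positive σ)))

  rows+d≡d*∏ : chain v d s + d ≡ d * ((s + 1) * P)
  rows+d≡d*∏ = trans (chain+gap v d s) (trans (cong (suc s *_) v+d≡d*P) (rearr d s P))
    where
    rearr : ∀ d s P → suc s * (d * P) ≡ d * ((s + 1) * P)
    rearr = solve-∀

  -- The `d` columns in excess of the rows stand for the missing final gap, so the columns split
  -- evenly into `suc s` pieces of width `v + d`.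
  n≡cols : n ≡ chain (v + d) 0 s
  n≡cols = begin
    n                        ≡⟨ n≡d*∏ ⟩
    d * ((s + 1) * P)        ≡⟨ rows+d≡d*∏ ⟨
    chain v d s + d          ≡⟨ chain+gap v d s ⟩
    suc s * (v + d)          ≡⟨ cong (suc s *_) (+-identityʳ (v + d)) ⟨
    suc s * (v + d + 0)      ≡⟨ chain+gap (v + d) 0 s ⟨
    chain (v + d) 0 s + 0    ≡⟨ +-identityʳ _ ⟩
    chain (v + d) 0 s        ∎
    where open ≡-Reasoning

  foldable : m ≡ chain v d s → n ≡ chain (v + d) 0 s → TreeFoldable (map (d *_) (s ∷ σ)) A
  foldable refl refl =
    Banded-chain⇒TreeFoldable d v s (Banded⇒TreeFoldable d σ refl v+d≡d*P) A banded

-- Translates the diagonals listed in the two definitions, at offsets `k` from 0 to `d`, into the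
-- inequalities of `Banded`.
inBand : ∀ {i j k d} → k ≤ d → j ≡ i + k → ¬ (j < i ⊎ i + d < j)
inBand {i} {k = k} _   refl (inj₁ i+k<i)   = m+n≮m i k i+k<i
inBand {i}         k≤d refl (inj₂ i+d<i+k) = ≤⇒≯ (+-monoʳ-≤ i k≤d) i+d<i+k

corollary1 : ∀ (τ : ℕ) → 1 ≤ τ → (σ : Vec ℕ τ) → All (1 ≤_) σ →
    let S = ∏[1+ σ ] in
    (∀ (A : Matrix (S ∸ 1) S) →
    BiDiagonal (transpose A) → IsTreeFoldUpToRowPermutation σ A)
    ×
    (∀ (A : Matrix (2 * S ∸ 2) (2 * S)) →
    TriDiagonal (transpose A) → IsTreeFoldUpToRowPermutation (map (2 *_) σ) A)
corollary1 (suc _) _ σ _ = bi , tri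
  where
  S : ℕ
  S = ∏[1+ σ ]

  bi : ∀ (A : Matrix (S ∸ 1) S) →
       BiDiagonal (transpose A) → IsTreeFoldUpToRowPermutation σ A
  bi A bidiagonal = TreeFoldable⇒IsTreeFoldUpToRowPermutation A
    -- For `d = 1` the level sizes come out as `map (1 *_) σ`.
    (subst (λ ρ → TreeFoldable ρ A) (trans (map-cong *-identityˡ σ) (map-id σ))
      (Banded⇒TreeFoldable 1 σ (m∸n+n≡m (∏[1+]-positive σ)) (sym (*-identityˡ S)) A
        (λ i j off → bidiagonal j i λ
          { (inj₁ j≡i)   → inBand z≤n (trans j≡i (sym (+-identityʳ (toℕ i)))) off
          ; (inj₂ j≡i+1) → inBand ≤-refl j≡i+1 off })))

  tri : ∀ (A : Matrix (2 * S ∸ 2) (2 * S)) →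
        TriDiagonal (transpose A) → IsTreeFoldUpToRowPermutation (map (2 *_) σ) A
  tri A tridiagonal = TreeFoldable⇒IsTreeFoldUpToRowPermutation A
    (Banded⇒TreeFoldable 2 σ (m∸n+n≡m (*-monoʳ-≤ 2 (∏[1+]-positive σ))) refl A
      (λ i j off → tridiagonal j i λ
        { (inj₁ j≡i)          → inBand z≤n (trans j≡i (sym (+-identityʳ (toℕ i)))) off
        ; (inj₂ (inj₁ j≡i+1)) → inBand (s≤s z≤n) j≡i+1 off
        ; (inj₂ (inj₂ j≡i+2)) → inBand ≤-refl j≡i+2 off }))
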